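{- Let $\mathcal{C}$ be a regular category, $F:\mathcal{C}\to\mathcal{C}$ an endofunctor, and $\alpha:X\to FX$, $\beta:Y\to FY$ two $F$-coalgebras. Then: \begin{itemize} \item a relation from $X$ to $Y$ is a regular AM-bisimulation from $\alpha$ to $\beta$ if and only if it is an HJ-bisimulation from $\alpha$ to $\beta$; \item if $\mathcal{C}$ has pushouts, then every regular AM-bisimulation from $\alpha$ to $\beta$ is included (as a subobject of $X\times Y$) in a behavioural equivalence from $\alpha$ to $\beta$; \item if $F$ covers pullbacks, then every behavioural equivalence from $\alpha$ to $\beta$ is a regular AM-bisimulation from $\alpha$ to $\beta$. \end{itemize}
   Context: A relation from $X$ to $Y$ is a subobject of $X\times Y$, i.e. an equivalence class of monos $m:R\rightarrowtail X\times Y$ (two monos being equivalent if each factors through the other); subobjects are ordered by factorisation of representing monos. $\pi_1,\pi_2$ denote the projections of a binary product. An $F$-coalgebra is a morphism $\alpha:X\to FX$; a coalgebra homomorphism from $\alpha:X\to FX$ to $\gamma:Z\to FZ$ is a morphism $f:X\to Z$ with $Ff\cdot\alpha=\gamma\cdot f$. Regular AM-bisimulation: a relation from $X$ to $Y$ is a regular AM-bisimulation from $\alpha$ to $\beta$ if for any mono $r:R\rightarrowtail X\times Y$ representing it there is a mono $w:W\rightarrowtail FR\times R$ such that $\pi_2\cdot w:W\to R$ is a regular epi and $$(\alpha\times\beta)\cdot r\cdot\pi_2\cdot w=\langle F\pi_1,F\pi_2\rangle\cdot Fr\cdot\pi_1\cdot w : W\to FX\times FY .$$ Hermida-Jacobs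 bisimulation (HJ-bisimulation): a relation from $X$ to $Y$ is an HJ-bisimulation from $\alpha$ to $\beta$ if there are a mono $r:R\rightarrowtail X\times Y$ representing it and a morphism $w:R\to\overline{F}R$ such that $m_r\cdot w=(\alpha\times\beta)\cdot r$, where $FR\xrightarrow{e_r}\overline{F}R\xrightarrow{m_r}FX\times FY$ is the (regular epi, mono)-factorisation of $\langle F\pi_1,F\pi_2\rangle\cdot Fr$. Behavioural equivalence: a relation from $X$ to $Y$ is a behavioural equivalence from $\alpha$ to $\beta$ if there are a coalgebra $\gamma:Z\to FZ$ and coalgebra homomorphisms $f$ from $\alpha$ to $\gamma$ and $g$ from $\beta$ to $\gamma$ such that the relation is represented by the mono $\langle u,v\rangle:R\rightarrowtail X\times Y$, where $X\xleftarrow{u}R\xrightarrow{v}Y$ is the pullback in $\mathcal{C}$ of $X\xrightarrow{f}Z\xleftarrow{g}Y$. $F$ covers pullbacks if, for every pullback $X\xleftarrow{u}R\xrightarrow{v}Y$ of a cospan $X\xrightarrow{f}Z\xleftarrow{g}Y$ and every pullback $FX\xleftarrow{u'}R'\xrightarrow{v'}FY$ of the cospan $FX\xrightarrow{Ff}FZ\xleftarrow{Fg}FY$, the unique morphism $c:FR\to R'$ with $u'\cdot c=Fu$ and $v'\cdot c=Fv$ is a regular epi. -}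

module Defs where

open import Level using (Level; suc; _⊔_)
open import Data.Product using (Σ-syntax; ∃!; _×_; proj₁)
open import Relation.Binary using (Rel; IsEquivalence)

private variable
  o ℓ e o′ ℓ′ e′ : Level

-- Hom-sets are setoids: equality of morphisms is the equivalence _≈_.
record Category (o ℓ e : Level) : Set (suc (o ⊔ ℓ ⊔ e)) where
  infix  4 _≈_ _⇒_
  infixr 9 _∘_
  field
    Obj : Set o
    _⇒_ : Obj → Obj → Set ℓ
    _≈_ : ∀ {A B} → Rel (A ⇒ B) e
    id  : ∀ {A} → A ⇒ A
    _∘_ : ∀ {A B C} → B ⇒ C → A ⇒ B → A ⇒ C
    isEquivalence : ∀ {A B} → IsEquivalence (_≈_ {A} {B})
    ∘-resp-≈  : ∀ {A B C} {f h : B ⇒ C} {g i : A ⇒ B} →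
                f ≈ h → g ≈ i → f ∘ g ≈ h ∘ i
    assoc     : ∀ {A B C D} {f : A ⇒ B} {g : B ⇒ C} {h : C ⇒ D} →
                (h ∘ g) ∘ f ≈ h ∘ (g ∘ f)
    identityˡ : ∀ {A B} {f : A ⇒ B} → id ∘ f ≈ f
    identityʳ : ∀ {A B} {f : A ⇒ B} → f ∘ id ≈ f

record Functor (C : Category o ℓ e) (D : Category o′ ℓ′ e′)
       : Set (o ⊔ ℓ ⊔ e ⊔ o′ ⊔ ℓ′ ⊔ e′) where
  private
    module C = Category C
    module D = Category D
  field
    F₀ : C.Obj → D.Obj
    F₁ : ∀ {A B} → A C.⇒ B → F₀ A D.⇒ F₀ B
    F-resp-≈     : ∀ {A B} {f g : A C.⇒ B} → f C.≈ g → F₁ f D.≈ F₁ g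
    identity     : ∀ {A} → F₁ (C.id {A}) D.≈ D.id
    homomorphism : ∀ {A B C} {f : A C.⇒ B} {g : B C.⇒ C} →
                   F₁ (g C.∘ f) D.≈ F₁ g D.∘ F₁ f

Endofunctor : Category o ℓ e → Set (o ⊔ ℓ ⊔ e)
Endofunctor C = Functor C C

module _ (C : Category o ℓ e) where
  open Category C

  Mono : ∀ {A B} → A ⇒ B → Set (o ⊔ ℓ ⊔ e)
  Mono {A} f = ∀ {Q} (g h : Q ⇒ A) → f ∘ g ≈ f ∘ h → g ≈ h

  IsTerminal : Obj → Set (o ⊔ ℓ ⊔ e)
  IsTerminal T = ∀ A → Σ[ t ∈ A ⇒ T ] (∀ (s : A ⇒ T) → t ≈ s)

  IsProduct : ∀ {A B P} → P ⇒ A → P ⇒ B → Set (o ⊔ ℓ ⊔ e)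
  IsProduct {A} {B} p₁ p₂ = ∀ {Q} (h : Q ⇒ A) (k : Q ⇒ B) →
    ∃! _≈_ λ t → p₁ ∘ t ≈ h × p₂ ∘ t ≈ k

  record IsEqualizer {E A B} (f g : A ⇒ B) (i : E ⇒ A) : Set (o ⊔ ℓ ⊔ e) where
    field
      equality  : f ∘ i ≈ g ∘ i
      universal : ∀ {Q} (h : Q ⇒ A) → f ∘ h ≈ g ∘ h →
                  ∃! _≈_ λ t → i ∘ t ≈ h

  record IsCoequalizer {A B Q} (f g : A ⇒ B) (q : B ⇒ Q) : Set (o ⊔ ℓ ⊔ e) where
    field
      equality  : q ∘ f ≈ q ∘ g
      universal : ∀ {Z} (h : B ⇒ Z) → h ∘ f ≈ h ∘ g →
                  ∃! _≈_ λ t → t ∘ q ≈ h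

  record IsPullback {X Y Z P} (f : X ⇒ Z) (g : Y ⇒ Z) (u : P ⇒ X) (v : P ⇒ Y)
         : Set (o ⊔ ℓ ⊔ e) where
    field
      commute   : f ∘ u ≈ g ∘ v
      universal : ∀ {Q} (h : Q ⇒ X) (k : Q ⇒ Y) → f ∘ h ≈ g ∘ k →
                  ∃! _≈_ λ t → u ∘ t ≈ h × v ∘ t ≈ k

  record IsPushout {X Y Z P} (f : Z ⇒ X) (g : Z ⇒ Y) (i : X ⇒ P) (j : Y ⇒ P)
         : Set (o ⊔ ℓ ⊔ e) where
    field
      commute   : i ∘ f ≈ j ∘ g
      universal : ∀ {Q} (h : X ⇒ Q) (k : Y ⇒ Q) → h ∘ f ≈ k ∘ g →
                  ∃! _≈_ λ t → t ∘ i ≈ h × t ∘ j ≈ k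

  HasPushouts : Set (o ⊔ ℓ ⊔ e)
  HasPushouts = ∀ {X Y Z} (f : Z ⇒ X) (g : Z ⇒ Y) →
    Σ[ P ∈ Obj ] Σ[ i ∈ X ⇒ P ] Σ[ j ∈ Y ⇒ P ] IsPushout f g i j

  RegularEpi : ∀ {A B} → A ⇒ B → Set (o ⊔ ℓ ⊔ e)
  RegularEpi {A} q =
    Σ[ K ∈ Obj ] Σ[ f ∈ K ⇒ A ] Σ[ g ∈ K ⇒ A ] IsCoequalizer f g q

  record FinitelyComplete : Set (o ⊔ ℓ ⊔ e) where
    infixr 7 _×ᶜ_
    infixr 8 _⁂_
    field
      ⊤          : Obj
      isTerminal : IsTerminal ⊤
      _×ᶜ_       : Obj → Obj → Obj
      π₁         : ∀ {A B} → A ×ᶜ B ⇒ A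
      π₂         : ∀ {A B} → A ×ᶜ B ⇒ B
      isProduct  : ∀ {A B} → IsProduct (π₁ {A} {B}) (π₂ {A} {B})
      equalizer  : ∀ {A B} (f g : A ⇒ B) →
                   Σ[ E ∈ Obj ] Σ[ i ∈ E ⇒ A ] IsEqualizer f g i

    ⟨_,_⟩ : ∀ {Q A B} → Q ⇒ A → Q ⇒ B → Q ⇒ A ×ᶜ B
    ⟨ h , k ⟩ = proj₁ (isProduct h k)

    _⁂_ : ∀ {A A′ B B′} → A ⇒ A′ → B ⇒ B′ → A ×ᶜ B ⇒ A′ ×ᶜ B′
    f ⁂ g = ⟨ f ∘ π₁ , g ∘ π₂ ⟩

  record Regular : Set (o ⊔ ℓ ⊔ e) where
    field
      finitelyComplete : FinitelyComplete
      kernelPair-coequalizer :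
        ∀ {A B K} (f : A ⇒ B) (p q : K ⇒ A) → IsPullback f f p q →
        Σ[ Q ∈ Obj ] Σ[ c ∈ A ⇒ Q ] IsCoequalizer p q c
      regularEpi-stable :
        ∀ {X Y Z P} (f : X ⇒ Z) (g : Y ⇒ Z) (u : P ⇒ X) (v : P ⇒ Y) →
        IsPullback f g u v → RegularEpi g → RegularEpi u

  -- A subobject is given by one of its representing monos; two elements of
  -- this type denote the same subobject when each is ≤ the other.
  record Subobject (A : Obj) : Set (o ⊔ ℓ ⊔ e) where
    field
      {dom} : Obj
      arr   : dom ⇒ A
      mono  : Mono arr

  module _ {A : Obj} where
    FactorsThrough : ∀ {R S} → R ⇒ A → S ⇒ A → Set (ℓ ⊔ e)
    FactorsThrough {R} {S} r s = Σ[ t ∈ R ⇒ S ] s ∘ t ≈ r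

    _≤_ : Subobject A → Subobject A → Set (ℓ ⊔ e)
    S ≤ T = FactorsThrough (Subobject.arr S) (Subobject.arr T)

    record Represents {R} (r : R ⇒ A) (S : Subobject A) : Set (o ⊔ ℓ ⊔ e) where
      field
        mono : Mono r
        to   : FactorsThrough r (Subobject.arr S)
        from : FactorsThrough (Subobject.arr S) r

  module _ (F : Endofunctor C) where
    open Functor F

    IsCoalgebraHom : ∀ {X Z} → X ⇒ F₀ X → Z ⇒ F₀ Z → X ⇒ Z → Set e
    IsCoalgebraHom α γ f = F₁ f ∘ α ≈ γ ∘ f

    -- Quantifying over all c with the two equations is harmless: they
    -- determine c uniquely, as u′ , v′ is a pullback.
    CoversPullbacks : Set (o ⊔ ℓ ⊔ e)
    CoversPullbacks =
      ∀ {X Y Z R R′} (f : X ⇒ Z) (g : Y ⇒ Z)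
      (u : R ⇒ X) (v : R ⇒ Y) (u′ : R′ ⇒ F₀ X) (v′ : R′ ⇒ F₀ Y) →
      IsPullback f g u v → IsPullback (F₁ f) (F₁ g) u′ v′ →
      ∀ (c : F₀ R ⇒ R′) → u′ ∘ c ≈ F₁ u → v′ ∘ c ≈ F₁ v → RegularEpi c

module Bisimulation (C : Category o ℓ e) (fc : FinitelyComplete C)
                    (F : Endofunctor C) where
  open Category C
  open FinitelyComplete fc
  open Functor F

  Relation : Obj → Obj → Set (o ⊔ ℓ ⊔ e)
  Relation X Y = Subobject C (X ×ᶜ Y)

  module _ {X Y : Obj} (α : X ⇒ F₀ X) (β : Y ⇒ F₀ Y) where

    IsRegularAMBisimulation : Relation X Y → Set (o ⊔ ℓ ⊔ e)
    IsRegularAMBisimulation S =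
      ∀ {R} (r : R ⇒ X ×ᶜ Y) → Represents C r S →
      Σ[ W ∈ Obj ] Σ[ w ∈ W ⇒ F₀ R ×ᶜ R ]
        Mono C w ×
        RegularEpi C (π₂ ∘ w) ×
        (α ⁂ β) ∘ r ∘ π₂ ∘ w ≈ ⟨ F₁ π₁ , F₁ π₂ ⟩ ∘ F₁ r ∘ π₁ ∘ w

    -- The (regular epi, mono)-factorisation m ∘ e is unique up to
    -- isomorphism, so it enters existentially.
    IsHJBisimulation : Relation X Y → Set (o ⊔ ℓ ⊔ e)
    IsHJBisimulation S =
      Σ[ R ∈ Obj ] Σ[ r ∈ R ⇒ X ×ᶜ Y ] Represents C r S ×
      (Σ[ F̄R ∈ Obj ] Σ[ e ∈ F₀ R ⇒ F̄R ] Σ[ m ∈ F̄R ⇒ F₀ X ×ᶜ F₀ Y ]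
        RegularEpi C e × Mono C m ×
        m ∘ e ≈ ⟨ F₁ π₁ , F₁ π₂ ⟩ ∘ F₁ r ×
        (Σ[ w ∈ R ⇒ F̄R ] m ∘ w ≈ (α ⁂ β) ∘ r))

    IsBehaviouralEquivalence : Relation X Y → Set (o ⊔ ℓ ⊔ e)
    IsBehaviouralEquivalence S =
      Σ[ Z ∈ Obj ] Σ[ γ ∈ Z ⇒ F₀ Z ] Σ[ f ∈ X ⇒ Z ] Σ[ g ∈ Y ⇒ Z ]
        IsCoalgebraHom C F α γ f × IsCoalgebraHom C F β γ g ×
        (Σ[ R ∈ Obj ] Σ[ u ∈ R ⇒ X ] Σ[ v ∈ R ⇒ Y ]
          IsPullback C f g u v × Represents C ⟨ u , v ⟩ S)

{-# OPTIONS --safe #-}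
-- In a regular category, a relation r is an HJ-bisimulation when the coalgebra
-- structure (α × β) ∘ r lifts along the mono part of the image factorisation
-- m ∘ e of ⟨ F π₁ , F π₂ ⟩ ∘ F r.  Pulling such a lift back along e yields the
-- witness W of a regular AM-bisimulation; conversely such a witness descends
-- along the regular epi W → R because m is mono.  As W → R is epi, the pushout
-- of the legs of r carries a coalgebra structure, and its pullback contains r.
-- If F covers pullbacks, the comparison F R → R′ followed by the inclusion of R′
-- into F X × F Y is the factorisation required of an HJ-bisimulation.
module Submission where

open import Data.Product using (Σ-syntax; _×_; _,_; proj₁; proj₂)
open import Function.Bundles using (_⇔_; mk⇔)
open import Level using (_⊔_)
open import Relation.Binary using (Setoid; IsEquivalence)
import Relation.Binary.Reasoning.Setoid as SetoidReasoning
open import Defs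

-- Epis, regular epis, pullbacks and representing monos in any category.

module CategoryProperties {o ℓ e} (C : Category o ℓ e) where
  open Category C

  hom-setoid : (A B : Obj) → Setoid ℓ e
  hom-setoid A B = record { Carrier = A ⇒ B ; isEquivalence = isEquivalence }

  module HomReasoning {A B : Obj} = SetoidReasoning (hom-setoid A B)

  module _ {A B : Obj} where
    open IsEquivalence (isEquivalence {A} {B}) public
      renaming (refl to ≈-refl; sym to ≈-sym; trans to ≈-trans)

  infixr 8 _⟩∘_ _∘⟨_

  _⟩∘_ : ∀ {A B C} {f g : B ⇒ C} → f ≈ g → (h : A ⇒ B) → f ∘ h ≈ g ∘ h
  p ⟩∘ h = ∘-resp-≈ p ≈-refl

  _∘⟨_ : ∀ {A B C} (h : B ⇒ C) {f g : A ⇒ B} → f ≈ g → h ∘ f ≈ h ∘ g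
  h ∘⟨ p = ∘-resp-≈ ≈-refl p

  pullˡ : ∀ {A B C D} {f : C ⇒ D} {g : B ⇒ C} {k : B ⇒ D} →
          f ∘ g ≈ k → (h : A ⇒ B) → f ∘ g ∘ h ≈ k ∘ h
  pullˡ p h = ≈-trans (≈-sym assoc) (p ⟩∘ h)

  extendˡ : ∀ {A B C C′ D} {f : C ⇒ D} {g : B ⇒ C} {f′ : C′ ⇒ D} {g′ : B ⇒ C′} →
            f ∘ g ≈ f′ ∘ g′ → (h : A ⇒ B) → f ∘ g ∘ h ≈ f′ ∘ g′ ∘ h
  extendˡ p h = ≈-trans (pullˡ p h) assoc

  cancelˡ : ∀ {A B C} {f : B ⇒ C} {g : C ⇒ B} →
            f ∘ g ≈ id → (h : A ⇒ C) → f ∘ g ∘ h ≈ h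
  cancelˡ p h = ≈-trans (pullˡ p h) identityˡ

  Epi : ∀ {A B} → A ⇒ B → Set (o ⊔ ℓ ⊔ e)
  Epi {B = B} f = ∀ {Q} (g h : B ⇒ Q) → g ∘ f ≈ h ∘ f → g ≈ h

  Epi-∘ : ∀ {A B D} {f : B ⇒ D} {g : A ⇒ B} → Epi f → Epi g → Epi (f ∘ g)
  Epi-∘ f-epi g-epi h k p =
    f-epi h k (g-epi _ _ (≈-trans assoc (≈-trans p (≈-sym assoc))))

  -- Both `h` and `k` mediate `k ∘ q` through the coequalizer, so uniqueness identifies them.
  IsCoequalizer⇒Epi : ∀ {A B Q} {f g : A ⇒ B} {q : B ⇒ Q} →
                      IsCoequalizer C f g q → Epi q
  IsCoequalizer⇒Epi {q = q} coeq h k p =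
    let _ , _ , unique = universal (k ∘ q)
          (≈-trans assoc (≈-trans (k ∘⟨ equality) (≈-sym assoc)))
    in ≈-trans (≈-sym (unique p)) (unique ≈-refl)
    where open IsCoequalizer coeq

  RegularEpi⇒Epi : ∀ {A B} {q : A ⇒ B} → RegularEpi C q → Epi q
  RegularEpi⇒Epi (_ , _ , _ , coeq) = IsCoequalizer⇒Epi coeq

  RegularEpi-resp-≈ : ∀ {A B} {q q′ : A ⇒ B} →
                      q ≈ q′ → RegularEpi C q → RegularEpi C q′
  RegularEpi-resp-≈ q≈q′ (K , f , g , coeq) = K , f , g , record
    { equality  = ≈-trans (≈-sym q≈q′ ⟩∘ f) (≈-trans equality (q≈q′ ⟩∘ g))
    ; universal = λ h p → let t , tq≈h , unique = universal h p in
        t , ≈-trans (t ∘⟨ ≈-sym q≈q′) tq≈h ,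
        λ {s} sq′≈h → unique (≈-trans (s ∘⟨ q≈q′) sq′≈h)
    }
    where open IsCoequalizer coeq

  -- The coequalized pair is transported along `j`. This permits a change of representing mono: an
  -- HJ-bisimulation provides its factorisation over one mono, whereas a regular AM-bisimulation
  -- must answer for all of them.
  RegularEpi-∘-iso : ∀ {A A′ B} {q : A ⇒ B} {i : A′ ⇒ A} {j : A ⇒ A′} →
                     i ∘ j ≈ id → j ∘ i ≈ id → RegularEpi C q → RegularEpi C (q ∘ i)
  RegularEpi-∘-iso {q = q} {i} {j} ij≈id ji≈id (K , f , g , coeq) =
    K , j ∘ f , j ∘ g , record
    { equality  = ≈-trans (qi∘j∘ f) (≈-trans equality (≈-sym (qi∘j∘ g)))
    ; universal = λ h p →
        let t , tq≈hj , unique = universal (h ∘ j)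
              (≈-trans assoc (≈-trans p (≈-sym assoc)))
        in t
         , ≈-trans (pullˡ tq≈hj i) (≈-trans assoc (≈-trans (h ∘⟨ ji≈id) identityʳ))
         , λ {s} s∘qi≈h → unique (begin
             s ∘ q              ≈⟨ s ∘⟨ identityʳ ⟨
             s ∘ q ∘ id         ≈⟨ s ∘⟨ q ∘⟨ ij≈id ⟨
             s ∘ q ∘ i ∘ j      ≈⟨ s ∘⟨ assoc ⟨
             s ∘ (q ∘ i) ∘ j    ≈⟨ pullˡ s∘qi≈h j ⟩
             h ∘ j              ∎)
    }
    where
    open IsCoequalizer coeq
    open HomReasoning
    qi∘j∘ : ∀ {K} (f : K ⇒ _) → (q ∘ i) ∘ j ∘ f ≈ q ∘ f
    qi∘j∘ f = ≈-trans assoc (q ∘⟨ cancelˡ ij≈id f)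

  -- Diagonal fill-in. Since `m` is mono and `g ∘ p` identifies the pair coequalized by `p`, so does
  -- `f`, which therefore descends along `p`; the triangle with `g` commutes because `p` is epi.
  RegularEpi-Mono-lift : ∀ {A B D E} {p : A ⇒ B} {m : D ⇒ E} {f : A ⇒ D} {g : B ⇒ E} →
    RegularEpi C p → Mono C m → m ∘ f ≈ g ∘ p → Σ[ t ∈ B ⇒ D ] m ∘ t ≈ g
  RegularEpi-Mono-lift {p = p} {m} {f} {g} (_ , a , b , coeq) m-mono mf≈gp =
    let t , tp≈f , _ = universal f (m-mono _ _ (begin
          m ∘ f ∘ a    ≈⟨ extendˡ mf≈gp a ⟩
          g ∘ p ∘ a    ≈⟨ g ∘⟨ equality ⟩
          g ∘ p ∘ b    ≈⟨ extendˡ mf≈gp b ⟨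
          m ∘ f ∘ b    ∎))
    in t , IsCoequalizer⇒Epi coeq (m ∘ t) g
             (≈-trans assoc (≈-trans (m ∘⟨ tp≈f) mf≈gp))
    where
    open IsCoequalizer coeq
    open HomReasoning

  IsPullback-jointlyMono : ∀ {X Y Z P Q} {f : X ⇒ Z} {g : Y ⇒ Z} {u : P ⇒ X} {v : P ⇒ Y} →
                           IsPullback C f g u v → {s t : Q ⇒ P} →
                           u ∘ s ≈ u ∘ t → v ∘ s ≈ v ∘ t → s ≈ t
  IsPullback-jointlyMono {f = f} {g} {u} {v} pb {s} {t} us≈ut vs≈vt =
    let _ , _ , unique = universal (u ∘ t) (v ∘ t) (extendˡ commute t)
    in ≈-trans (≈-sym (unique (us≈ut , vs≈vt))) (unique (≈-refl , ≈-refl))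
    where open IsPullback pb

  Subobject⇒Represents : ∀ {A} (S : Subobject C A) → Represents C (Subobject.arr S) S
  Subobject⇒Represents S = record
    { mono = Subobject.mono S
    ; to   = id , identityʳ
    ; from = id , identityʳ
    }

  -- The two monos factor through each other by way of `S`, and cancelling each mono makes the
  -- factorisations mutually inverse.
  Represents⇒iso : ∀ {A R R′} {r : R ⇒ A} {r′ : R′ ⇒ A} {S : Subobject C A} →
                   Represents C r S → Represents C r′ S →
                   Σ[ i ∈ R ⇒ R′ ] Σ[ j ∈ R′ ⇒ R ]
                     r′ ∘ i ≈ r × i ∘ j ≈ id × j ∘ i ≈ id
  Represents⇒iso {r = r} {r′} {S} rep rep′ =
    i , j , r′i≈r , inverse (mono rep′) r′i≈r rj≈r′ , inverse (mono rep) rj≈r′ r′i≈r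
    where
    open Represents
    compose : ∀ {R R′} {r : R ⇒ _} {r′ : R′ ⇒ _} →
              (rep : Represents C r S) (rep′ : Represents C r′ S) →
              r′ ∘ proj₁ (from rep′) ∘ proj₁ (to rep) ≈ r
    compose rep rep′ =
      ≈-trans (pullˡ (proj₂ (from rep′)) (proj₁ (to rep))) (proj₂ (to rep))
    i = proj₁ (from rep′) ∘ proj₁ (to rep)
    j = proj₁ (from rep) ∘ proj₁ (to rep′)
    r′i≈r : r′ ∘ i ≈ r
    r′i≈r = compose rep rep′
    rj≈r′ : r ∘ j ≈ r′
    rj≈r′ = compose rep′ rep
    inverse : ∀ {A R R′} {m : R ⇒ A} {n : R′ ⇒ A} {s : R′ ⇒ R} {t : R ⇒ R′} →
              Mono C m → m ∘ s ≈ n → n ∘ t ≈ m → s ∘ t ≈ id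
    inverse {t = t} m-mono ms≈n nt≈m =
      m-mono _ _ (≈-trans (pullˡ ms≈n t) (≈-trans nt≈m (≈-sym identityʳ)))

-- Binary products, jointly monic pairs and pullbacks.

module ProductProperties {o ℓ e} (C : Category o ℓ e) (fc : FinitelyComplete C) where
  open Category C
  open CategoryProperties C
  open FinitelyComplete fc

  module _ {A B Q : Obj} {h : Q ⇒ A} {k : Q ⇒ B} where
    project₁ : π₁ ∘ ⟨ h , k ⟩ ≈ h
    project₁ = proj₁ (proj₁ (proj₂ (isProduct h k)))

    project₂ : π₂ ∘ ⟨ h , k ⟩ ≈ k
    project₂ = proj₂ (proj₁ (proj₂ (isProduct h k)))

  π-jointlyMono : ∀ {A B Q} {s t : Q ⇒ A ×ᶜ B} → π₁ ∘ s ≈ π₁ ∘ t → π₂ ∘ s ≈ π₂ ∘ t → s ≈ t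
  π-jointlyMono {s = s} {t} p q =
    let _ , _ , unique = isProduct (π₁ ∘ t) (π₂ ∘ t)
    in ≈-trans (≈-sym (unique (p , q))) (unique (≈-refl , ≈-refl))

  ⟨⟩∘ : ∀ {A B Q Q′} {h : Q ⇒ A} {k : Q ⇒ B} {s : Q′ ⇒ Q} →
        ⟨ h , k ⟩ ∘ s ≈ ⟨ h ∘ s , k ∘ s ⟩
  ⟨⟩∘ {s = s} = π-jointlyMono (≈-trans (pullˡ project₁ s) (≈-sym project₁))
                              (≈-trans (pullˡ project₂ s) (≈-sym project₂))

  ⟨⟩-cong : ∀ {A B Q} {h h′ : Q ⇒ A} {k k′ : Q ⇒ B} →
            h ≈ h′ → k ≈ k′ → ⟨ h , k ⟩ ≈ ⟨ h′ , k′ ⟩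
  ⟨⟩-cong p q = π-jointlyMono (≈-trans project₁ (≈-trans p (≈-sym project₁)))
                              (≈-trans project₂ (≈-trans q (≈-sym project₂)))

  ⟨⟩-injective : ∀ {A B Q} {h h′ : Q ⇒ A} {k k′ : Q ⇒ B} →
                 ⟨ h , k ⟩ ≈ ⟨ h′ , k′ ⟩ → h ≈ h′ × k ≈ k′
  ⟨⟩-injective p = ≈-trans (≈-sym project₁) (≈-trans (π₁ ∘⟨ p) project₁)
                 , ≈-trans (≈-sym project₂) (≈-trans (π₂ ∘⟨ p) project₂)

  jointlyMono⇒Mono : ∀ {A B P} {u : P ⇒ A} {v : P ⇒ B} →
    (∀ {Q} {s t : Q ⇒ P} → u ∘ s ≈ u ∘ t → v ∘ s ≈ v ∘ t → s ≈ t) → Mono C ⟨ u , v ⟩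
  jointlyMono⇒Mono jm s t p = jm (component project₁) (component project₂)
    where
    component : ∀ {D} {π : _ ⇒ D} {u} → π ∘ ⟨ _ , _ ⟩ ≈ u → u ∘ s ≈ u ∘ t
    component {π = π} q =
      ≈-trans (≈-sym (pullˡ q s)) (≈-trans (π ∘⟨ p) (pullˡ q t))

  IsPullback⇒Mono : ∀ {X Y Z P} {f : X ⇒ Z} {g : Y ⇒ Z} {u : P ⇒ X} {v : P ⇒ Y} →
                    IsPullback C f g u v → Mono C ⟨ u , v ⟩
  IsPullback⇒Mono pb = jointlyMono⇒Mono (IsPullback-jointlyMono pb)

  -- The usual construction from a product and an equalizer, the limits that `FinitelyComplete`
  -- supplies.
  pullback : ∀ {X Y Z} (f : X ⇒ Z) (g : Y ⇒ Z) →
             Σ[ P ∈ Obj ] Σ[ u ∈ P ⇒ X ] Σ[ v ∈ P ⇒ Y ] IsPullback C f g u v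
  pullback f g with E , i , eq ← equalizer (f ∘ π₁) (g ∘ π₂) =
    E , π₁ ∘ i , π₂ ∘ i , record
    { commute   = ≈-trans (≈-sym assoc) (≈-trans equality assoc)
    ; universal = λ h k fh≈gk →
        let t , it≈hk , unique = universal ⟨ h , k ⟩
              (≈-trans assoc (≈-trans (f ∘⟨ project₁) (≈-trans fh≈gk
                (≈-trans (g ∘⟨ ≈-sym project₂) (≈-sym assoc)))))
        in t
         , ( ≈-trans assoc (≈-trans (π₁ ∘⟨ it≈hk) project₁)
           , ≈-trans assoc (≈-trans (π₂ ∘⟨ it≈hk) project₂) )
         , λ (p , q) → unique (π-jointlyMono
             (≈-trans (≈-sym assoc) (≈-trans p (≈-sym project₁)))
             (≈-trans (≈-sym assoc) (≈-trans q (≈-sym project₂))))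
    }
    where open IsEqualizer eq

-- Image factorisation in a regular category.

module RegularProperties {o ℓ e} (C : Category o ℓ e) (reg : Regular C) where
  open Category C
  open CategoryProperties C
  open Regular reg
  open ProductProperties C finitelyComplete

  RegularEpi-pullback : ∀ {X Y Z} (f : X ⇒ Z) (q : Y ⇒ Z) → RegularEpi C q →
    Σ[ P ∈ Obj ] Σ[ u ∈ P ⇒ X ] Σ[ v ∈ P ⇒ Y ] IsPullback C f q u v × RegularEpi C u
  RegularEpi-pullback f q q-regular with P , u , v , pb ← pullback f q =
    P , u , v , pb , regularEpi-stable f q u v pb q-regular

  -- g and h are covered by maps a, b into A over a common epi u₁ ∘ u₂; there
  -- m ∘ g ≈ m ∘ h says that (a , b) lies in the kernel pair, which q identifies.
  kernelPair-mono : ∀ {A B I K} {f : A ⇒ B} {k₁ k₂ : K ⇒ A} {q : A ⇒ I} {m : I ⇒ B} →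
    IsPullback C f f k₁ k₂ → IsCoequalizer C k₁ k₂ q → m ∘ q ≈ f → Mono C m
  kernelPair-mono {f = f} {k₁} {k₂} {q} {m} kp coeq mq≈f g h mg≈mh =
    let q-regular = _ , k₁ , k₂ , coeq
        P₁ , u₁ , a₁ , pb₁ , u₁-regular = RegularEpi-pullback g q q-regular
        P₂ , u₂ , b , pb₂ , u₂-regular = RegularEpi-pullback (h ∘ u₁) q q-regular
        a = a₁ ∘ u₂
        gu≈qa : g ∘ u₁ ∘ u₂ ≈ q ∘ a
        gu≈qa = extendˡ (IsPullback.commute pb₁) u₂
        hu≈qb : h ∘ u₁ ∘ u₂ ≈ q ∘ b
        hu≈qb = ≈-trans (≈-sym assoc) (IsPullback.commute pb₂)
        fa≈fb : f ∘ a ≈ f ∘ b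
        fa≈fb = begin
          f ∘ a              ≈⟨ pullˡ mq≈f a ⟨
          m ∘ q ∘ a          ≈⟨ m ∘⟨ gu≈qa ⟨
          m ∘ g ∘ u₁ ∘ u₂    ≈⟨ extendˡ mg≈mh (u₁ ∘ u₂) ⟩
          m ∘ h ∘ u₁ ∘ u₂    ≈⟨ m ∘⟨ hu≈qb ⟩
          m ∘ q ∘ b          ≈⟨ pullˡ mq≈f b ⟩
          f ∘ b              ∎
        s , (k₁s≈a , k₂s≈b) , _ = IsPullback.universal kp a b fa≈fb
    in Epi-∘ (RegularEpi⇒Epi u₁-regular) (RegularEpi⇒Epi u₂-regular) g h (begin
         g ∘ u₁ ∘ u₂    ≈⟨ gu≈qa ⟩
         q ∘ a          ≈⟨ q ∘⟨ k₁s≈a ⟨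
         q ∘ k₁ ∘ s     ≈⟨ extendˡ (IsCoequalizer.equality coeq) s ⟩
         q ∘ k₂ ∘ s     ≈⟨ q ∘⟨ k₂s≈b ⟩
         q ∘ b          ≈⟨ hu≈qb ⟨
         h ∘ u₁ ∘ u₂    ∎)
    where open HomReasoning

  -- The image is the quotient of the domain by the kernel pair of `f`; `f` itself identifies that
  -- pair, which gives `m`.
  factorise : ∀ {A B} (f : A ⇒ B) →
    Σ[ I ∈ Obj ] Σ[ q ∈ A ⇒ I ] Σ[ m ∈ I ⇒ B ] RegularEpi C q × Mono C m × m ∘ q ≈ f
  factorise f =
    let K , k₁ , k₂ , kp = pullback f f
        I , q , coeq = kernelPair-coequalizer f k₁ k₂ kp
        m , mq≈f , _ = IsCoequalizer.universal coeq f (IsPullback.commute kp)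
    in I , q , m , (K , k₁ , k₂ , coeq) , kernelPair-mono kp coeq mq≈f , mq≈f

-- Comparison of the three notions of bisimulation.

module BisimulationProperties {o ℓ e} (C : Category o ℓ e) (reg : Regular C)
                              (F : Endofunctor C) where
  open Category C
  open CategoryProperties C
  open Regular reg
  open FinitelyComplete finitelyComplete
  open ProductProperties C finitelyComplete
  open RegularProperties C reg
  open Functor F
  open Bisimulation C finitelyComplete F
  open HomReasoning

  F-resp-∘≈∘ : ∀ {A B B′ D} {f : B ⇒ D} {g : A ⇒ B} {f′ : B′ ⇒ D} {g′ : A ⇒ B′} →
               f ∘ g ≈ f′ ∘ g′ → F₁ f ∘ F₁ g ≈ F₁ f′ ∘ F₁ g′
  F-resp-∘≈∘ p = ≈-trans (≈-sym homomorphism) (≈-trans (F-resp-≈ p) homomorphism)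

  F-inverse : ∀ {A B} {i : A ⇒ B} {j : B ⇒ A} → i ∘ j ≈ id → F₁ i ∘ F₁ j ≈ id
  F-inverse p = ≈-trans (≈-sym homomorphism) (≈-trans (F-resp-≈ p) identity)

  ⟨F⟩∘F : ∀ {R X Y} (r : R ⇒ X ×ᶜ Y) →
          ⟨ F₁ π₁ , F₁ π₂ ⟩ ∘ F₁ r ≈ ⟨ F₁ (π₁ ∘ r) , F₁ (π₂ ∘ r) ⟩
  ⟨F⟩∘F r = ≈-trans ⟨⟩∘ (⟨⟩-cong (≈-sym homomorphism) (≈-sym homomorphism))

  module _ {X Y : Obj} (α : X ⇒ F₀ X) (β : Y ⇒ F₀ Y) where

    ⁂∘ : ∀ {R} (r : R ⇒ X ×ᶜ Y) → (α ⁂ β) ∘ r ≈ ⟨ α ∘ π₁ ∘ r , β ∘ π₂ ∘ r ⟩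
    ⁂∘ r = ≈-trans ⟨⟩∘ (⟨⟩-cong assoc assoc)

    -- After factorising, the AM equation is a commutative square with the regular epi `π₂ ∘ w` on
    -- one side and the mono `m` on the other; its diagonal is the HJ structure.
    regularAM⇒HJ : (S : Relation X Y) → IsRegularAMBisimulation α β S → IsHJBisimulation α β S
    regularAM⇒HJ S am =
      let r = Subobject.arr S
          _ , w , _ , w₂-regular , square = am r (Subobject⇒Represents S)
          I , q , m , q-regular , m-mono , mq≈ = factorise (⟨ F₁ π₁ , F₁ π₂ ⟩ ∘ F₁ r)
      in _ , r , Subobject⇒Represents S , I , q , m , q-regular , m-mono , mq≈ ,
         RegularEpi-Mono-lift w₂-regular m-mono (begin
           m ∘ q ∘ π₁ ∘ w                            ≈⟨ extendˡ mq≈ (π₁ ∘ w) ⟩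
           ⟨ F₁ π₁ , F₁ π₂ ⟩ ∘ F₁ r ∘ π₁ ∘ w         ≈⟨ square ⟨
           (α ⁂ β) ∘ r ∘ π₂ ∘ w                      ≈⟨ assoc ⟨
           ((α ⁂ β) ∘ r) ∘ π₂ ∘ w                    ∎)

    HJ⇒regularAM : (S : Relation X Y) → IsHJBisimulation α β S → IsRegularAMBisimulation α β S
    HJ⇒regularAM S (R₀ , r₀ , rep₀ , I , q , m , q-regular , _ , mq≈ , t , mt≈) r rep =
      let i , j , r₀i≈r , ij≈id , ji≈id = Represents⇒iso rep rep₀
          -- The HJ data live over `r₀`, so `t` and `q` are moved to `R` along `i`. Functors
          -- preserve isomorphisms, hence `q ∘ F₁ i` is still a regular epi, and stability passes
          -- this on to `w₂`.
          W , w₂ , w₁ , pb , w₂-regular = RegularEpi-pullback (t ∘ i) (q ∘ F₁ i)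
            (RegularEpi-∘-iso (F-inverse ij≈id) (F-inverse ji≈id) q-regular)
          F² = ⟨ F₁ π₁ , F₁ π₂ ⟩
      in W , ⟨ w₁ , w₂ ⟩
       -- The swap reflects that the pullback lists its leg into `R` first, while the witness has
       -- `F₀ R` as first factor.
       , jointlyMono⇒Mono (λ p₁ p₂ → IsPullback-jointlyMono pb p₂ p₁)
       , RegularEpi-resp-≈ (≈-sym project₂) w₂-regular
       , (begin
           (α ⁂ β) ∘ r ∘ π₂ ∘ ⟨ w₁ , w₂ ⟩    ≈⟨ (α ⁂ β) ∘⟨ r ∘⟨ project₂ ⟩
           (α ⁂ β) ∘ r ∘ w₂                  ≈⟨ (α ⁂ β) ∘⟨ pullˡ r₀i≈r w₂ ⟨
           (α ⁂ β) ∘ r₀ ∘ i ∘ w₂             ≈⟨ extendˡ mt≈ (i ∘ w₂) ⟨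
           m ∘ t ∘ i ∘ w₂                    ≈⟨ m ∘⟨ assoc ⟨
           m ∘ (t ∘ i) ∘ w₂                  ≈⟨ m ∘⟨ IsPullback.commute pb ⟩
           m ∘ (q ∘ F₁ i) ∘ w₁               ≈⟨ m ∘⟨ assoc ⟩
           m ∘ q ∘ F₁ i ∘ w₁                 ≈⟨ extendˡ mq≈ (F₁ i ∘ w₁) ⟩
           F² ∘ F₁ r₀ ∘ F₁ i ∘ w₁            ≈⟨ F² ∘⟨ pullˡ (≈-sym homomorphism) w₁ ⟩
           F² ∘ F₁ (r₀ ∘ i) ∘ w₁             ≈⟨ F² ∘⟨ F-resp-≈ r₀i≈r ⟩∘ w₁ ⟩
           F² ∘ F₁ r ∘ w₁                    ≈⟨ F² ∘⟨ F₁ r ∘⟨ project₁ ⟨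
           F² ∘ F₁ r ∘ π₁ ∘ ⟨ w₁ , w₂ ⟩      ∎)

    AM-square-legs : ∀ {R W} (r : R ⇒ X ×ᶜ Y) (w₁ : W ⇒ F₀ R) (w₂ : W ⇒ R) →
      (α ⁂ β) ∘ r ∘ w₂ ≈ ⟨ F₁ π₁ , F₁ π₂ ⟩ ∘ F₁ r ∘ w₁ →
      (α ∘ π₁ ∘ r) ∘ w₂ ≈ F₁ (π₁ ∘ r) ∘ w₁ × (β ∘ π₂ ∘ r) ∘ w₂ ≈ F₁ (π₂ ∘ r) ∘ w₁
    AM-square-legs r w₁ w₂ square = ⟨⟩-injective (begin
      ⟨ (α ∘ π₁ ∘ r) ∘ w₂ , (β ∘ π₂ ∘ r) ∘ w₂ ⟩    ≈⟨ ⟨⟩∘ ⟨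
      ⟨ α ∘ π₁ ∘ r , β ∘ π₂ ∘ r ⟩ ∘ w₂             ≈⟨ pullˡ (⁂∘ r) w₂ ⟨
      (α ⁂ β) ∘ r ∘ w₂                             ≈⟨ square ⟩
      ⟨ F₁ π₁ , F₁ π₂ ⟩ ∘ F₁ r ∘ w₁                ≈⟨ pullˡ (⟨F⟩∘F r) w₁ ⟩
      ⟨ F₁ (π₁ ∘ r) , F₁ (π₂ ∘ r) ⟩ ∘ w₁           ≈⟨ ⟨⟩∘ ⟩
      ⟨ F₁ (π₁ ∘ r) ∘ w₁ , F₁ (π₂ ∘ r) ∘ w₁ ⟩      ∎)

    -- This is the compatibility that induces a coalgebra structure on the pushout. It may be tested
    -- after the epi `w₂`, where the AM equation trades `α` and `β` for `F₁` of the legs of `r`;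
    -- then `F₁` of the cocone equation applies.
    regularAM⇒coalgebra-cocone : ∀ {R W Z} (r : R ⇒ X ×ᶜ Y) (w₁ : W ⇒ F₀ R) (w₂ : W ⇒ R) →
      RegularEpi C w₂ → (α ⁂ β) ∘ r ∘ w₂ ≈ ⟨ F₁ π₁ , F₁ π₂ ⟩ ∘ F₁ r ∘ w₁ →
      (f : X ⇒ Z) (g : Y ⇒ Z) → f ∘ π₁ ∘ r ≈ g ∘ π₂ ∘ r →
      (F₁ f ∘ α) ∘ π₁ ∘ r ≈ (F₁ g ∘ β) ∘ π₂ ∘ r
    regularAM⇒coalgebra-cocone r w₁ w₂ w₂-regular square f g fr≈gr =
      let square₁ , square₂ = AM-square-legs r w₁ w₂ square
      in RegularEpi⇒Epi w₂-regular _ _ (begin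
        ((F₁ f ∘ α) ∘ π₁ ∘ r) ∘ w₂    ≈⟨ assoc ⟩∘ w₂ ⟩
        (F₁ f ∘ α ∘ π₁ ∘ r) ∘ w₂      ≈⟨ assoc ⟩
        F₁ f ∘ (α ∘ π₁ ∘ r) ∘ w₂      ≈⟨ F₁ f ∘⟨ square₁ ⟩
        F₁ f ∘ F₁ (π₁ ∘ r) ∘ w₁       ≈⟨ extendˡ (F-resp-∘≈∘ fr≈gr) w₁ ⟩
        F₁ g ∘ F₁ (π₂ ∘ r) ∘ w₁       ≈⟨ F₁ g ∘⟨ square₂ ⟨
        F₁ g ∘ (β ∘ π₂ ∘ r) ∘ w₂      ≈⟨ assoc ⟨
        (F₁ g ∘ β ∘ π₂ ∘ r) ∘ w₂      ≈⟨ assoc ⟩∘ w₂ ⟨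
        ((F₁ g ∘ β) ∘ π₂ ∘ r) ∘ w₂    ∎)

    regularAM⇒≤behavioural : HasPushouts C → (S : Relation X Y) → IsRegularAMBisimulation α β S →
      Σ[ T ∈ Relation X Y ] (IsBehaviouralEquivalence α β T × _≤_ C S T)
    regularAM⇒≤behavioural pushouts S am =
      let r = Subobject.arr S
          _ , w , _ , w₂-regular , square = am r (Subobject⇒Represents S)
          Z , f , g , po = pushouts (π₁ ∘ r) (π₂ ∘ r)
          P , u , v , pb = pullback f g
          fr≈gr = IsPushout.commute po
          -- The mediating equations of `γ` are, reversed, the homomorphism conditions on `f` and
          -- `g`.
          γ , (γf≈Ffα , γg≈Fgβ) , _ = IsPushout.universal po (F₁ f ∘ α) (F₁ g ∘ β)
            (regularAM⇒coalgebra-cocone r (π₁ ∘ w) (π₂ ∘ w) w₂-regular square f g fr≈gr)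
          -- The pushout square commutes, so the legs of `r` form a cone over `f` and `g`; the
          -- induced `s` is the inclusion of `S`.
          s , (us≈r₁ , vs≈r₂) , _ = IsPullback.universal pb (π₁ ∘ r) (π₂ ∘ r) fr≈gr
          T = record { arr = ⟨ u , v ⟩ ; mono = IsPullback⇒Mono pb }
      in T
       , ( Z , γ , f , g , ≈-sym γf≈Ffα , ≈-sym γg≈Fgβ
         , P , u , v , pb , Subobject⇒Represents T )
       , s , π-jointlyMono (≈-trans (pullˡ project₁ s) us≈r₁)
                           (≈-trans (pullˡ project₂ s) vs≈r₂)

    -- Allows the factorisation and the lift to be checked leg by leg, the form in which the
    -- pullback of `F₁ f` and `F₁ g` delivers them.
    ⟨⟩-isHJ : ∀ {R I} (S : Relation X Y) (u : R ⇒ X) (v : R ⇒ Y) → Represents C ⟨ u , v ⟩ S →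
      (q : F₀ R ⇒ I) (m₁ : I ⇒ F₀ X) (m₂ : I ⇒ F₀ Y) (t : R ⇒ I) →
      RegularEpi C q → Mono C ⟨ m₁ , m₂ ⟩ →
      m₁ ∘ q ≈ F₁ u → m₂ ∘ q ≈ F₁ v → m₁ ∘ t ≈ α ∘ u → m₂ ∘ t ≈ β ∘ v →
      IsHJBisimulation α β S
    ⟨⟩-isHJ S u v rep q m₁ m₂ t q-regular m-mono m₁q≈ m₂q≈ m₁t≈ m₂t≈ =
      let r = ⟨ u , v ⟩
      in _ , r , rep , _ , q , ⟨ m₁ , m₂ ⟩ , q-regular , m-mono
       , (begin
           ⟨ m₁ , m₂ ⟩ ∘ q                  ≈⟨ ⟨⟩∘ ⟩
           ⟨ m₁ ∘ q , m₂ ∘ q ⟩              ≈⟨ ⟨⟩-cong m₁q≈ m₂q≈ ⟩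
           ⟨ F₁ u , F₁ v ⟩                  ≈⟨ ⟨⟩-cong (F-resp-≈ project₁) (F-resp-≈ project₂) ⟨
           ⟨ F₁ (π₁ ∘ r) , F₁ (π₂ ∘ r) ⟩    ≈⟨ ⟨F⟩∘F r ⟨
           ⟨ F₁ π₁ , F₁ π₂ ⟩ ∘ F₁ r         ∎)
       , t
       , (begin
           ⟨ m₁ , m₂ ⟩ ∘ t                  ≈⟨ ⟨⟩∘ ⟩
           ⟨ m₁ ∘ t , m₂ ∘ t ⟩              ≈⟨ ⟨⟩-cong m₁t≈ m₂t≈ ⟩
           ⟨ α ∘ u , β ∘ v ⟩                ≈⟨ ⟨⟩-cong (α ∘⟨ project₁) (β ∘⟨ project₂) ⟨
           ⟨ α ∘ π₁ ∘ r , β ∘ π₂ ∘ r ⟩      ≈⟨ ⁂∘ r ⟨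
           (α ⁂ β) ∘ r                      ∎)

    behavioural⇒HJ : CoversPullbacks C F → (S : Relation X Y) →
                     IsBehaviouralEquivalence α β S → IsHJBisimulation α β S
    behavioural⇒HJ covers S (Z , γ , f , g , f-hom , g-hom , R , u , v , pb , rep) =
      let R′ , u′ , v′ , pb′ = pullback (F₁ f) (F₁ g)
          open IsPullback pb using (commute)
          open IsPullback pb′ using (universal)
          c , (u′c≈Fu , v′c≈Fv) , _ = universal (F₁ u) (F₁ v) (F-resp-∘≈∘ commute)
          -- Both composites pass through `γ` because `f` and `g` are homomorphisms, and there the
          -- pullback square of `f` and `g` makes them agree.
          t , (u′t≈αu , v′t≈βv) , _ = universal (α ∘ u) (β ∘ v) (begin
            F₁ f ∘ α ∘ u    ≈⟨ extendˡ f-hom u ⟩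
            γ ∘ f ∘ u       ≈⟨ γ ∘⟨ commute ⟩
            γ ∘ g ∘ v       ≈⟨ extendˡ g-hom v ⟨
            F₁ g ∘ β ∘ v    ∎)
      in ⟨⟩-isHJ S u v rep c u′ v′ t
           (covers f g u v u′ v′ pb pb′ c u′c≈Fu v′c≈Fv) (IsPullback⇒Mono pb′)
           u′c≈Fu v′c≈Fv u′t≈αu v′t≈βv

theorem2p18 : ∀ {o ℓ e} (C : Category o ℓ e) (reg : Regular C) (F : Endofunctor C) →
    let open Category C
        open Functor F
        open Bisimulation C (Regular.finitelyComplete reg) F
    in
    ∀ {X Y : Obj} (α : X ⇒ F₀ X) (β : Y ⇒ F₀ Y) →
      (∀ (S : Relation X Y) →
         IsRegularAMBisimulation α β S ⇔ IsHJBisimulation α β S)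
      × (HasPushouts C → ∀ (S : Relation X Y) →
         IsRegularAMBisimulation α β S →
         Σ[ T ∈ Relation X Y ] (IsBehaviouralEquivalence α β T × _≤_ C S T))
      × (CoversPullbacks C F → ∀ (S : Relation X Y) →
         IsBehaviouralEquivalence α β S → IsRegularAMBisimulation α β S)
theorem2p18 C reg F α β =
    (λ S → mk⇔ {A = IsRegularAMBisimulation α β S}
               (regularAM⇒HJ α β S) (HJ⇒regularAM α β S))
  , regularAM⇒≤behavioural α β
  -- HJ-bisimulations are the intermediate notion: the comparison `c` gives a factorisation
  -- directly, and the first equivalence turns it into a witness for every representing mono.
  , (λ covers S be → HJ⇒regularAM α β S (behavioural⇒HJ α β covers S be))
  where
  open Bisimulation C (Regular.finitelyComplete reg) F
  open BisimulationProperties C reg F
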